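{- Let $d\ge1$ be an integer. For all nonnegative integers $n_1,\ldots,n_d$, $$\mathsf{p}(n_1,\ldots,n_d)=\left|\left\{\pi\in\mathcal{P}^{(d)}:(c_1(\pi),\ldots,c_d(\pi))=(n_1,\ldots,n_d)\right\}\right|.$$
   Context: A $d$-dimensional partition is an array $\pi = (\pi_{i_1,\ldots,i_d})_{i_1,\ldots,i_d\ge 1}$ of nonnegative integers with only finitely many nonzero entries such that $\pi_{i_1,\ldots,i_d}\ge \pi_{j_1,\ldots,j_d}$ whenever $i_1\le j_1,\ldots,i_d\le j_d$; $\mathcal{P}^{(d)}$ is the set of all $d$-dimensional partitions. With $\mathbb{Z}_+$ the set of positive integers, the diagram of $\pi$ is $D(\pi)=\{(i_1,\ldots,i_d,i)\in\mathbb{Z}_+^{d+1}: 1\le i\le\pi_{i_1,\ldots,i_d}\}$. Let $\mathbf{e}_1,\ldots,\mathbf{e}_{d+1}$ be the standard basis of $\mathbb{Z}^{d+1}$ and $[d]=\{1,\ldots,d\}$. The set of corners of $\pi$ is $$\mathrm{Cor}(\pi)=\{\mathbf{i}\in\mathbb{Z}_+^{d+1}:\mathbf{i}\in D(\pi),\ \mathbf{i}+\mathbf{e}_\ell\notin D(\pi)\text{ for all }\ell\in[d]\}$$ (only the first $d$ directions are tested). For $\ell\in[d]$ define $$c_\ell(\pi)=\sum_{(i_1,\ldots,i_{d+1})\in\mathrm{Cor}(\pi)}i_\ell.$$ The vector partition numbers $\mathsf{p}(n_1,\ldots,n_d)$ are defined by the formal power series identity $$\sum_{n_1,\ldots,n_d\ge0}\mathsf{p}(n_1,\ldots,n_d)\,x_1^{n_1}\cdots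 x_d^{n_d} = \prod_{i_1,\ldots,i_d\ge1}\left(1-x_1^{i_1}\cdots x_d^{i_d}\right)^{ -1}.$$ -}

module Defs where

open import Data.Bool.Base using (if_then_else_)
open import Data.Fin.Base using (Fin)
open import Data.Fin.Properties using (all?)
open import Data.Integer.Base as ℤ using (ℤ; 0ℤ; 1ℤ)
open import Data.List.Base as List
  using (List; []; _∷_; foldr; filter; concatMap; deduplicate; upTo; cartesianProductWith)
open import Data.List.Membership.Propositional using (_∈_; find; lose)
open import Data.List.Membership.Propositional.Properties
  using (∈-filter⁺; ∈-filter⁻; ∈-concatMap⁺; ∈-concatMap⁻; ∈-map⁺; ∈-map⁻; ∈-upTo⁺; ∈-upTo⁻;
         ∈-deduplicate⁺)
open import Data.List.Relation.Binary.Subset.Propositional using (_⊆_)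
import Data.List.Relation.Unary.All.Properties as All
import Data.List.Relation.Unary.AllPairs as AllPairs
import Data.List.Relation.Unary.AllPairs.Properties as AllPairs
open import Data.List.Relation.Unary.All using (universal)
open import Data.List.Relation.Unary.Unique.Propositional using (Unique)
open import Data.List.Relation.Unary.Unique.Propositional.Properties
  using (concat⁺; map⁺; upTo⁺; filter⁺)
open import Data.List.Relation.Unary.Unique.DecPropositional.Properties using (deduplicate-!)
open import Data.Nat.Base using (ℕ; suc; _+_; _∸_; _≤_; s≤s)
open import Data.Nat.ListAction using (sum)
open import Data.Nat.Properties using (_≤?_; m<n⇒n≢0) renaming (_≟_ to _≟ℕ_)
open import Data.Product.Base using (Σ; ∃; _×_; _,_; proj₁; proj₂)
open import Data.Vec.Base as Vec using (Vec; []; _∷_; lookup; tabulate; replicate; zipWith; _[_]%=_)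
open import Data.Vec.Properties using (≡-dec)
open import Data.Vec.Relation.Binary.Pointwise.Inductive using (Pointwise)
open import Function.Base using (_∘_)
open import Function.Bundles using (_⇔_; mk⇔; Equivalence; Bijection)
open import Level using (0ℓ)
open import Relation.Binary.Bundles using (Setoid)
open import Relation.Binary.Definitions using (DecidableEquality)
import Relation.Binary.Construct.On as On
open import Relation.Binary.PropositionalEquality
  using (_≡_; _≢_; refl; sym; trans; cong; setoid; _→-setoid_)
open import Relation.Nullary using (¬_; ¬?; does; map′)
open import Relation.Nullary.Decidable using (_×-dec_)
open import Relation.Unary using (Decidable)

------------------------------------------------------------------------
-- Positive integers

-- `1+ n` stands for the positive integer suc n.
record ℤ₊ : Set where
  constructor 1+_
  field pred : ℕ

value : ℤ₊ → ℕ
value (1+ n) = suc n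

infix 4 _≤₊_ _≟₊_

_≤₊_ : ℤ₊ → ℤ₊ → Set
i ≤₊ j = value i ≤ value j

succ₊ : ℤ₊ → ℤ₊
succ₊ (1+ n) = 1+ suc n

_≟₊_ : DecidableEquality ℤ₊
(1+ m) ≟₊ (1+ n) = map′ (cong 1+_) (cong ℤ₊.pred) (m ≟ℕ n)

Index : ℕ → Set
Index d = Vec ℤ₊ d

------------------------------------------------------------------------
-- d-dimensional partitions

-- Finiteness of the support is witnessed by a list containing it.  The list
-- may have repetitions and superfluous members, and is ignored by the
-- equality of partitions below.
record Partition (d : ℕ) : Set where
  field
    part       : Index d → ℕ
    decreasing : ∀ {i j} → Pointwise _≤₊_ i j → part j ≤ part i
    finite     : ∃ λ (is : List (Index d)) → ∀ i → part i ≢ 0 → i ∈ is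

open Partition public using (part)

PartitionSetoid : ℕ → Setoid 0ℓ 0ℓ
PartitionSetoid d = On.setoid (Index d →-setoid ℕ) (part {d})

-- A point (i₁,…,i_d,i) of ℤ₊^(d+1) is the pair of (i₁,…,i_d) and i.
Point : ℕ → Set
Point d = Index d × ℤ₊

-- Addition of the ℓ-th standard basis vector, for ℓ ∈ [d].
_+e_ : ∀ {d} → Point d → Fin d → Point d
(is , i) +e ℓ = is [ ℓ ]%= succ₊ , i

module _ {d : ℕ} (π : Partition d) where

  Diagram : Point d → Set
  Diagram (is , i) = value i ≤ part π is

  Corner : Point d → Set
  Corner v = Diagram v × (∀ ℓ → ¬ Diagram (v +e ℓ))

  diagram? : Decidable Diagram
  diagram? (is , i) = value i ≤? part π is

  corner? : Decidable Corner
  corner? v = diagram? v ×-dec all? (λ ℓ → ¬? (diagram? (v +e ℓ)))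

  private
    support : List (Index d)
    support = deduplicate (≡-dec _≟₊_) (proj₁ (Partition.finite π))

    column : Index d → List (Point d)
    column is = List.map (λ k → is , 1+ k) (upTo (part π is))

  diagram : List (Point d)
  diagram = concatMap column support

  corners : List (Point d)
  corners = filter corner? diagram

  -- The next four lemmas show that `diagram` and `corners` list each element
  -- of D(π), respectively of Cor(π), exactly once.

  ∈-diagram : ∀ {v} → v ∈ diagram ⇔ Diagram v
  ∈-diagram {is , i} = mk⇔ to from
    where
    to : (is , i) ∈ diagram → Diagram (is , i)
    to p with find (∈-concatMap⁻ column {xs = support} p)
    ... | js , _ , q with ∈-map⁻ (λ k → js , 1+ k) q
    ... | _ , k∈ , refl = ∈-upTo⁻ k∈

    from : Diagram (is , i) → (is , i) ∈ diagram
    from i≤ = ∈-concatMap⁺ column (lose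
      (∈-deduplicate⁺ (≡-dec _≟₊_) (proj₂ (Partition.finite π) is (m<n⇒n≢0 i≤)))
      (∈-map⁺ (λ k → is , 1+ k) (∈-upTo⁺ i≤)))

  diagram-unique : Unique diagram
  diagram-unique = concat⁺
    (All.map⁺ (universal (λ is → map⁺ (λ { refl → refl }) (upTo⁺ (part π is))) support))
    (AllPairs.map⁺ (AllPairs.map disjoint
      (deduplicate-! (≡-dec _≟₊_) (proj₁ (Partition.finite π)))))
    where
    base : ∀ is {v} → v ∈ column is → proj₁ v ≡ is
    base is p with ∈-map⁻ (λ k → is , 1+ k) p
    ... | _ , _ , refl = refl

    disjoint : ∀ {is js} → is ≢ js → ∀ {v} → ¬ (v ∈ column is × v ∈ column js)
    disjoint is≢js (p , q) = is≢js (trans (sym (base _ p)) (base _ q))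

  ∈-corners : ∀ {v} → v ∈ corners ⇔ Corner v
  ∈-corners = mk⇔
    (λ p → proj₂ (∈-filter⁻ corner? {xs = diagram} p))
    (λ c → ∈-filter⁺ corner? (Equivalence.from ∈-diagram (proj₁ c)) c)

  corners-unique : Unique corners
  corners-unique = filter⁺ corner? diagram-unique

  c : Fin d → ℕ
  c ℓ = sum (List.map (λ (is , _) → value (lookup is ℓ)) corners)

-- The set of partitions π with (c₁(π),…,c_d(π)) = n, as a subsetoid.
CornerFibre : ∀ {d} → Vec ℕ d → Setoid 0ℓ 0ℓ
CornerFibre {d} n =
  On.setoid {B = Σ (Partition d) (λ π → tabulate (c π) ≡ n)} (PartitionSetoid d) proj₁

HasCardinality : Setoid 0ℓ 0ℓ → ℕ → Set
HasCardinality S k = Bijection (setoid (Fin k)) S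

------------------------------------------------------------------------
-- Formal power series in x₁,…,x_d over ℤ

-- A series is given by its coefficients, indexed by exponent vectors.
Series : ℕ → Set
Series d = Vec ℕ d → ℤ

infix  4 _≈_
infixl 6 _-_
infixl 7 _*_

_≈_ : ∀ {d} → Series d → Series d → Set
f ≈ g = ∀ n → f n ≡ g n

x^_ : ∀ {d} → Vec ℕ d → Series d
(x^ a) n = if does (≡-dec _≟ℕ_ a n) then 1ℤ else 0ℤ

𝟏 : ∀ {d} → Series d
𝟏 = x^ replicate _ 0

_-_ : ∀ {d} → Series d → Series d → Series d
(f - g) n = f n ℤ.- g n

-- All exponent vectors that are componentwise at most n.
below : ∀ {d} → Vec ℕ d → List (Vec ℕ d)
below []       = [] ∷ []
below (n ∷ ns) = cartesianProductWith _∷_ (upTo (suc n)) (below ns)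

_*_ : ∀ {d} → Series d → Series d → Series d
(f * g) n = foldr ℤ._+_ 0ℤ (List.map (λ k → f k ℤ.* g (zipWith _∸_ n k)) (below n))

∏ : ∀ {d} {I : Set} → List I → (I → Series d) → Series d
∏ is f = foldr (λ i → f i *_) 𝟏 is

-- F is the product of the family f over all of I: each coefficient of the
-- products over finite subsets of I is eventually that of F, along the
-- finite subsets ordered by inclusion.
IsInfiniteProduct : ∀ {d} {I : Set} → (I → Series d) → Series d → Set
IsInfiniteProduct {I = I} f F =
  ∀ n → ∃ λ (S₀ : List I) → ∀ S → Unique S → S₀ ⊆ S → ∏ S f n ≡ F n

-- The identity  Σ p(n) xⁿ = ∏_{i ∈ ℤ₊^d} (1 - x^i)⁻¹  that defines the vector
-- partition numbers p.
record IsVectorPartitionNumbers {d : ℕ} (p : Vec ℕ d → ℤ) : Set where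
  field
    inverse   : Index d → Series d
    isInverse : ∀ i → (𝟏 - x^ Vec.map value i) * inverse i ≈ 𝟏
    isProduct : IsInfiniteProduct inverse p

{-# OPTIONS --safe #-}
module Submission where

-- Put a_i = π_i − max_ℓ π_{i+e_ℓ}.  The corners of π above i are the (i , k) with
-- max_ℓ π_{i+e_ℓ} < k ≤ π_i, so there are a_i of them and c(π) = Σ_i a_i i.  The recursion
-- π_i = a_i + max_ℓ π_{i+e_ℓ} recovers π from a, and any finitely supported a arises in
-- this way, so the π with c(π) = n correspond to the finitely supported a with
-- Σ_i a_i i = n.  Expanding (1 − xⁱ)⁻¹ as a geometric series, p(n) counts the latter.

open import Defs
open import Data.Bool.Base using (true; false; if_then_else_)
open import Data.Fin.Base using (Fin; zero; suc)
open import Data.Integer.Base as ℤ using (ℤ; +_; 0ℤ; 1ℤ)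
import Data.Integer.Properties as ℤ
open import Data.Integer.Tactic.RingSolver using (solve-∀)
open import Data.List.Base as List
  using (List; []; _∷_; _++_; length; foldr; concatMap; deduplicate; upTo)
open import Data.List.Membership.Propositional using (_∈_; _∉_; find; lose)
open import Data.List.Membership.Propositional.Properties
  using (∈-concatMap⁺; ∈-concatMap⁻; ∈-map⁺; ∈-map⁻; ∈-upTo⁺; ∈-upTo⁻; ∈-cartesianProductWith⁺;
         ∈-cartesianProductWith⁻; ∈-deduplicate⁺; ∈-++⁺ˡ; ∈-++⁺ʳ; ∈-lookup)
open import Data.List.Properties
  using (length-++; length-map; map-cong; tabulate-cong; map-++; map-∘; length-upTo)
open import Data.List.Membership.Propositional.Properties.WithK using (unique∧set⇒bag)
open import Data.List.Relation.Binary.BagAndSetEquality using (∼bag⇒↭)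
open import Data.List.Relation.Binary.Permutation.Propositional using (_↭_)
import Data.List.Relation.Binary.Permutation.Propositional.Properties as ↭
open import Data.List.Relation.Unary.All as All using (All; []; _∷_)
import Data.List.Relation.Unary.All.Properties as All
open import Data.List.Relation.Unary.AllPairs as AllPairs using ([]; _∷_)
import Data.List.Relation.Unary.AllPairs.Properties as AllPairs
open import Data.List.Relation.Unary.Any using (here; there; index)
import Data.List.Relation.Unary.Any.Properties as Any
open import Data.List.Relation.Unary.Unique.Propositional using (Unique)
open import Data.List.Relation.Unary.Unique.Propositional.Properties
  using (concat⁺; map⁺; upTo⁺; cartesianProductWith⁺)
open import Data.List.Relation.Unary.Unique.DecPropositional.Properties using (deduplicate-!)
open import Data.Nat.Base as ℕ using (ℕ; zero; suc; _+_; _∸_; _≤_; _<_; z≤n; s≤s)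
import Data.Nat.Properties as ℕ
open import Data.Nat.ListAction using (sum)
open import Data.Nat.ListAction.Properties using (sum-++; sum-↭)
open import Data.List.Extrema ℕ.≤-totalOrder using (max; max≤v⁺; xs≤max)
open import Data.Product.Base using (Σ; ∃; _×_; _,_; proj₁; proj₂)
open import Data.Vec.Base as Vec using (Vec; []; _∷_; lookup; replicate; zipWith; head)
open import Data.Vec.Properties as Vec using (≡-dec; ∷-injective; ∷-injectiveˡ; ∷-injectiveʳ)
open import Data.Vec.Relation.Binary.Pointwise.Inductive as Pointwise using (Pointwise; []; _∷_; decidable)
open import Function.Base using (_∘_)
open import Function.Bundles using (mk⇔; Equivalence)
open import Relation.Binary.PropositionalEquality
open import Relation.Nullary using (¬_; Dec; yes; no; does; contradiction)

-- Arithmetic of exponent vectors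

infix 4 _≤ᵛ_
infixl 6 _+ᵛ_ _∸ᵛ_
infixl 7 _·_

_≤ᵛ_ : ∀ {d} → Vec ℕ d → Vec ℕ d → Set
_≤ᵛ_ = Pointwise _≤_

_+ᵛ_ _∸ᵛ_ : ∀ {d} → Vec ℕ d → Vec ℕ d → Vec ℕ d
_+ᵛ_ = zipWith _+_
_∸ᵛ_ = zipWith _∸_

_·_ : ∀ {d} → ℕ → Vec ℕ d → Vec ℕ d
j · a = Vec.map (j ℕ.*_) a

exponent : ∀ {d} → Index d → Vec ℕ d
exponent = Vec.map value

0≤ᵛ : ∀ {d} (n : Vec ℕ d) → replicate d 0 ≤ᵛ n
0≤ᵛ []      = []
0≤ᵛ (_ ∷ n) = z≤n ∷ 0≤ᵛ n

n∸ᵛ0≡n : ∀ {d} (n : Vec ℕ d) → n ∸ᵛ replicate d 0 ≡ n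
n∸ᵛ0≡n []      = refl
n∸ᵛ0≡n (_ ∷ n) = cong (_ ∷_) (n∸ᵛ0≡n n)

m+ᵛ[n∸m]≡n : ∀ {d} {m n : Vec ℕ d} → m ≤ᵛ n → m +ᵛ (n ∸ᵛ m) ≡ n
m+ᵛ[n∸m]≡n []            = refl
m+ᵛ[n∸m]≡n (m≤n ∷ ms≤ns) = cong₂ _∷_ (ℕ.m+[n∸m]≡n m≤n) (m+ᵛ[n∸m]≡n ms≤ns)

m+ᵛn∸m≡n : ∀ {d} (m n : Vec ℕ d) → (m +ᵛ n) ∸ᵛ m ≡ n
m+ᵛn∸m≡n []      []      = refl
m+ᵛn∸m≡n (m ∷ ms) (n ∷ ns) = cong₂ _∷_ (ℕ.m+n∸m≡n m n) (m+ᵛn∸m≡n ms ns)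

m≤ᵛm+n : ∀ {d} (m n : Vec ℕ d) → m ≤ᵛ m +ᵛ n
m≤ᵛm+n []       []       = []
m≤ᵛm+n (m ∷ ms) (n ∷ ns) = ℕ.m≤m+n m n ∷ m≤ᵛm+n ms ns

0·a≡0 : ∀ {d} (a : Vec ℕ d) → 0 · a ≡ replicate d 0
0·a≡0 []      = refl
0·a≡0 (_ ∷ a) = cong (0 ∷_) (0·a≡0 a)

suc-· : ∀ {d} j (a : Vec ℕ d) → suc j · a ≡ a +ᵛ j · a
suc-· j []      = refl
suc-· j (x ∷ a) = cong (_ ∷_) (suc-· j a)

∈-below⁺ : ∀ {d} {k n : Vec ℕ d} → k ≤ᵛ n → k ∈ below n
∈-below⁺ []          = here refl
∈-below⁺ (k≤n ∷ k≤n′) = ∈-cartesianProductWith⁺ _∷_ (∈-upTo⁺ (s≤s k≤n)) (∈-below⁺ k≤n′)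

∈-below⁻ : ∀ {d} {k : Vec ℕ d} n → k ∈ below n → k ≤ᵛ n
∈-below⁻ []      (here refl) = []
∈-below⁻ (n ∷ ns) k∈ with ∈-cartesianProductWith⁻ _∷_ (upTo (suc n)) (below ns) k∈
... | _ , _ , i∈ , js∈ , refl = ℕ.s≤s⁻¹ (∈-upTo⁻ i∈) ∷ ∈-below⁻ ns js∈

below-unique : ∀ {d} (n : Vec ℕ d) → Unique (below n)
below-unique []       = [] ∷ []
below-unique (n ∷ ns) = cartesianProductWith⁺ _∷_ ∷-injective (upTo⁺ (suc n)) (below-unique ns)

-- Power series

∑ : {A : Set} → List A → (A → ℤ) → ℤ
∑ xs f = foldr ℤ._+_ 0ℤ (List.map f xs)

∑-cong : {A : Set} (xs : List A) {f g : A → ℤ} → (∀ x → f x ≡ g x) → ∑ xs f ≡ ∑ xs g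
∑-cong xs f≗g = cong (foldr ℤ._+_ 0ℤ) (map-cong f≗g xs)

∑-sub : {A : Set} (xs : List A) (f g : A → ℤ) → ∑ xs (λ x → f x ℤ.- g x) ≡ ∑ xs f ℤ.- ∑ xs g
∑-sub []       f g = refl
∑-sub (x ∷ xs) f g = trans (cong (λ s → f x ℤ.- g x ℤ.+ s) (∑-sub xs f g)) (regroup (f x) (g x) _ _)
  where
  regroup : ∀ a b c e → a ℤ.- b ℤ.+ (c ℤ.- e) ≡ a ℤ.+ c ℤ.- (b ℤ.+ e)
  regroup = solve-∀

x^-self : ∀ {d} (a : Vec ℕ d) → (x^ a) a ≡ 1ℤ
x^-self a with ≡-dec ℕ._≟_ a a
... | yes _  = refl
... | no a≢a = contradiction refl a≢a

x^-other : ∀ {d} {a k : Vec ℕ d} → a ≢ k → (x^ a) k ≡ 0ℤ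
x^-other {a = a} {k} a≢k with ≡-dec ℕ._≟_ a k
... | yes a≡k = contradiction a≡k a≢k
... | no _    = refl

∑-x^-∉ : ∀ {d} {a : Vec ℕ d} (h : Vec ℕ d → ℤ) {ks} → a ∉ ks → ∑ ks (λ k → (x^ a) k ℤ.* h k) ≡ 0ℤ
∑-x^-∉ h {[]}     a∉ = refl
∑-x^-∉ h {k ∷ ks} a∉ =
  cong₂ (λ u v → u ℤ.* h k ℤ.+ v) (x^-other (a∉ ∘ here)) (∑-x^-∉ h (a∉ ∘ there))

∑-x^-∈ : ∀ {d} {a : Vec ℕ d} (h : Vec ℕ d → ℤ) {ks} → Unique ks → a ∈ ks →
         ∑ ks (λ k → (x^ a) k ℤ.* h k) ≡ h a
∑-x^-∈ {a = a} h (a≢ks ∷ _) (here refl) =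
  trans (cong₂ (λ u v → u ℤ.* h a ℤ.+ v) (x^-self a) (∑-x^-∉ h (λ a∈ → All.lookup a≢ks a∈ refl)))
        (trans (ℤ.+-identityʳ _) (ℤ.*-identityˡ (h a)))
∑-x^-∈ h {k ∷ _} (k≢ks ∷ !ks) (there a∈) =
  trans (cong₂ (λ u v → u ℤ.* h k ℤ.+ v)
               (x^-other (λ a≡k → All.lookup k≢ks a∈ (sym a≡k))) (∑-x^-∈ h !ks a∈))
        (ℤ.+-identityˡ _)

-- Only the term `k = a` of the convolution survives, and `below n` lists `a` exactly once because
-- `a ≤ᵛ n`.
x^-*-≤ : ∀ {d} {a n : Vec ℕ d} (g : Series d) → a ≤ᵛ n → ((x^ a) * g) n ≡ g (n ∸ᵛ a)
x^-*-≤ {n = n} g a≤n = ∑-x^-∈ (λ k → g (n ∸ᵛ k)) (below-unique n) (∈-below⁺ a≤n)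

x^-*-≰ : ∀ {d} {a n : Vec ℕ d} (g : Series d) → ¬ a ≤ᵛ n → ((x^ a) * g) n ≡ 0ℤ
x^-*-≰ {n = n} g a≰n = ∑-x^-∉ (λ k → g (n ∸ᵛ k)) (a≰n ∘ ∈-below⁻ n)

𝟏-x^-* : ∀ {d} (a : Vec ℕ d) (g : Series d) n → ((𝟏 - (x^ a)) * g) n ≡ g n ℤ.- ((x^ a) * g) n
𝟏-x^-* a g n = begin
  ((𝟏 - (x^ a)) * g) n
    ≡⟨ ∑-cong (below n) (λ k → distrib (𝟏 k) ((x^ a) k) (g (n ∸ᵛ k))) ⟩
  ∑ (below n) (λ k → 𝟏 k ℤ.* g (n ∸ᵛ k) ℤ.- (x^ a) k ℤ.* g (n ∸ᵛ k))
    ≡⟨ ∑-sub (below n) _ _ ⟩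
  (𝟏 * g) n ℤ.- ((x^ a) * g) n
    ≡⟨ cong (λ s → s ℤ.- ((x^ a) * g) n) (trans (x^-*-≤ g (0≤ᵛ n)) (cong g (n∸ᵛ0≡n n))) ⟩
  g n ℤ.- ((x^ a) * g) n
    ∎
  where
  open ≡-Reasoning
  distrib : ∀ u v w → (u ℤ.- v) ℤ.* w ≡ u ℤ.* w ℤ.- v ℤ.* w
  distrib = solve-∀

-- Coefficients of an inverse of 1 - x^a

IsMultiple : ∀ {d} → Vec ℕ d → Vec ℕ d → Set
IsMultiple a n = ∃ λ j → j · a ≡ n

-- The equation gives `g = 𝟏 + x^a g`, so the coefficient at `n` comes from the one at `n - a`. The
-- positive head of `a` makes the head of `n` drop, so the descent ends. The decision is returned
-- with the coefficient because both come from the same descent.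
geometric : ∀ {d} x (xs : Vec ℕ d) (let a = suc x ∷ xs) (g : Series (suc d)) → (𝟏 - (x^ a)) * g ≈ 𝟏 →
            ∀ n → Σ (Dec (IsMultiple a n)) λ a∣n? → g n ≡ (if does a∣n? then 1ℤ else 0ℤ)
geometric {d} x xs g inv = λ n → go (suc (head n)) n ℕ.≤-refl
  where
  a = suc x ∷ xs

  recurrence : ∀ n → g n ≡ 𝟏 n ℤ.+ ((x^ a) * g) n
  recurrence n = begin
    g n                                        ≡⟨ cancel (g n) (((x^ a) * g) n) ⟩
    g n ℤ.- ((x^ a) * g) n ℤ.+ ((x^ a) * g) n
      ≡⟨ cong (λ s → s ℤ.+ ((x^ a) * g) n) (trans (sym (𝟏-x^-* a g n)) (inv n)) ⟩
    𝟏 n ℤ.+ ((x^ a) * g) n                     ∎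
    where
    open ≡-Reasoning
    cancel : ∀ u v → u ≡ u ℤ.- v ℤ.+ v
    cancel = solve-∀

  go : ∀ b n → head n < b → Σ (Dec (IsMultiple a n)) λ a∣n? → g n ≡ (if does a∣n? then 1ℤ else 0ℤ)
  go (suc b) n n<b with decidable ℕ._≤?_ a n
  go (suc b) (zero ∷ _)     _         | yes (() ∷ _)
  -- At an exponent with positive head `𝟏` evaluates to 0, so the recurrence reads
  -- `g n ≡ g (n ∸ᵛ a)`. The multiplier 0 is impossible here for the same reason.
  go (suc b) n@(suc m ∷ ns) (s≤s m<b) | yes a≤n@(_ ∷ _)
    with go b (n ∸ᵛ a) (ℕ.≤-<-trans (ℕ.m∸n≤m m x) m<b)
       | trans (recurrence n) (trans (ℤ.+-identityˡ _) (x^-*-≤ g a≤n))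
  ... | yes (j , ja≡n∸a) , eq | gn≡ =
    yes (suc j , trans (suc-· j a) (trans (cong (a +ᵛ_) ja≡n∸a) (m+ᵛ[n∸m]≡n a≤n))) , trans gn≡ eq
  ... | no a∤n∸a , eq | gn≡ =
    no (λ { (suc j , refl) → a∤n∸a (j , sym (trans (cong (_∸ᵛ a) (suc-· j a)) (m+ᵛn∸m≡n a (j · a)))) }) ,
    trans gn≡ eq
  -- The shifted term vanishes and `g n` is the coefficient of `𝟏`; every positive multiple of `a`
  -- lies above `a`, so only `0 · a` can equal `n`.
  go (suc b) n n<b | no a≰n
    with ≡-dec ℕ._≟_ (replicate _ 0) n
       | trans (recurrence n) (trans (cong (λ s → 𝟏 n ℤ.+ s) (x^-*-≰ g a≰n)) (ℤ.+-identityʳ _))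
  ... | yes refl | gn≡ = yes (0 , 0·a≡0 a) , trans gn≡ (x^-self n)
  ... | no 0≢n   | gn≡ = no (λ
    { (zero  , 0a≡n) → 0≢n (trans (sym (0·a≡0 a)) 0a≡n)
    ; (suc j , ja≡n) → a≰n (subst (a ≤ᵛ_) (trans (sym (suc-· j a)) ja≡n) (m≤ᵛm+n a (j · a))) }) ,
    trans gn≡ (x^-other 0≢n)

-- Finite products count multiplicity vectors

-- The vector holds the multiplicities of the parts listed in `S`. Its weight is the exponent
-- obtained by choosing the corresponding term from each geometric series.
weight : ∀ {d} (S : List (Index d)) → Vec ℕ (length S) → Vec ℕ d
weight []      []       = replicate _ 0
weight (i ∷ S) (m ∷ ms) = m · exponent i +ᵛ weight S ms

+length-concatMap : {A B : Set} (f : A → List B) (xs : List A) →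
                    + length (concatMap f xs) ≡ ∑ xs (λ x → + length (f x))
+length-concatMap f []       = refl
+length-concatMap f (x ∷ xs) =
  trans (cong +_ (length-++ (f x))) (cong (λ s → + length (f x) ℤ.+ s) (+length-concatMap f xs))

-- The decider is a parameter so that it can be the one that `geometric` returns along with the
-- coefficients.
module Solutions {d} (multiple? : ∀ i n → Dec (IsMultiple (exponent {suc d} i) n)) where

  prepend : ∀ {a n : Vec ℕ (suc d)} {r} → Dec (IsMultiple a n) → List (Vec ℕ r) → List (Vec ℕ (suc r))
  prepend (yes (j , _)) mss = List.map (j ∷_) mss
  prepend (no _)        mss = []

  -- The enumeration follows the recursion of `∏` and the convolution over `below n`, so its length
  -- obeys the same recursion as the coefficient of the product.
  solutions : (S : List (Index (suc d))) → Vec ℕ (suc d) → List (Vec ℕ (length S))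
  solutions []      n = if does (≡-dec ℕ._≟_ (replicate _ 0) n) then [] ∷ [] else []
  solutions (i ∷ S) n = concatMap (λ k → prepend (multiple? i k) (solutions S (n ∸ᵛ k))) (below n)

  ∈-prepend⁻ : ∀ {a n : Vec ℕ (suc d)} {r m} {ms : Vec ℕ r} (a∣n? : Dec (IsMultiple a n)) {mss} →
               m ∷ ms ∈ prepend a∣n? mss → m · a ≡ n × ms ∈ mss
  ∈-prepend⁻ (yes (j , ja≡n)) m∷ms∈ with ∈-map⁻ (j ∷_) m∷ms∈
  ... | _ , ms∈ , refl = ja≡n , ms∈

  -- The first entry of an index is positive and can be cancelled. Hence the multiplier found by the
  -- decider is the only one.
  ·-injective : ∀ (i : Index (suc d)) {j k} → j · exponent i ≡ k · exponent i → j ≡ k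
  ·-injective ((1+ x) ∷ _) {j} {k} eq = ℕ.*-cancelʳ-≡ j k (suc x) (∷-injectiveˡ eq)

  ∈-prepend⁺ : ∀ (i : Index (suc d)) {n r m} {ms : Vec ℕ r} (i∣n? : Dec (IsMultiple (exponent i) n)) {mss} →
               m · exponent i ≡ n → ms ∈ mss → m ∷ ms ∈ prepend i∣n? mss
  ∈-prepend⁺ i {m = m} (yes (j , ji≡n)) mi≡n ms∈
    with refl ← ·-injective i {m} {j} (trans mi≡n (sym ji≡n)) = ∈-map⁺ (j ∷_) ms∈
  ∈-prepend⁺ i {m = m} (no i∤n) mi≡n ms∈ = contradiction (m , mi≡n) i∤n

  prepend-unique : ∀ {a n : Vec ℕ (suc d)} {r} (a∣n? : Dec (IsMultiple a n)) {mss : List (Vec ℕ r)} →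
                   Unique mss → Unique (prepend a∣n? mss)
  prepend-unique (yes _) !mss = map⁺ ∷-injectiveʳ !mss
  prepend-unique (no _)  _    = []

  ∈-solutions⁻ : ∀ S n {ms} → ms ∈ solutions S n → weight S ms ≡ n
  ∈-solutions⁻ [] n {ms} ms∈ with ≡-dec ℕ._≟_ (replicate (suc d) 0) n
  ∈-solutions⁻ [] n {[]} ms∈ | yes 0≡n = 0≡n
  ∈-solutions⁻ (i ∷ S) n {m ∷ ms} m∷ms∈
    with find (∈-concatMap⁻ (λ k → prepend (multiple? i k) (solutions S (n ∸ᵛ k))) {xs = below n} m∷ms∈)
  ... | k , k∈ , m∷ms∈′ with ∈-prepend⁻ (multiple? i k) m∷ms∈′
  ... | mi≡k , ms∈ = trans (cong₂ _+ᵛ_ mi≡k (∈-solutions⁻ S (n ∸ᵛ k) ms∈)) (m+ᵛ[n∸m]≡n (∈-below⁻ n k∈))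

  ∈-solutions-[] : ∀ {n} → replicate (suc d) 0 ≡ n → [] ∈ solutions [] n
  ∈-solutions-[] {n} 0≡n with ≡-dec ℕ._≟_ (replicate (suc d) 0) n
  ... | yes _  = here refl
  ... | no 0≢n = contradiction 0≡n 0≢n

  ∈-solutions⁺ : ∀ S ms → ms ∈ solutions S (weight S ms)
  ∈-solutions⁺ [] [] = ∈-solutions-[] refl
  ∈-solutions⁺ (i ∷ S) (m ∷ ms) = ∈-concatMap⁺ (λ k → prepend (multiple? i k) (solutions S (_ ∸ᵛ k)))
    (lose (∈-below⁺ (m≤ᵛm+n k (weight S ms)))
          (∈-prepend⁺ i (multiple? i k) refl
            (subst (λ n → ms ∈ solutions S n) (sym (m+ᵛn∸m≡n k (weight S ms))) (∈-solutions⁺ S ms))))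
    where k = m · exponent i

  solutions-unique : ∀ S n → Unique (solutions S n)
  solutions-unique [] n with does (≡-dec ℕ._≟_ (replicate (suc d) 0) n)
  ... | true  = [] ∷ []
  ... | false = []
  solutions-unique (i ∷ S) n = concat⁺
    (All.map⁺ (All.universal (λ k → prepend-unique (multiple? i k) (solutions-unique S (n ∸ᵛ k))) (below n)))
    (AllPairs.map⁺ (AllPairs.map
      -- The first multiplicity `m` determines `k` as `m · exponent i`, so distinct `k` give
      -- disjoint lists.
      (λ { k≢l {m ∷ ms} (p , q) → k≢l (trans (sym (proj₁ (∈-prepend⁻ (multiple? i _) p)))
                                            (proj₁ (∈-prepend⁻ (multiple? i _) q))) })
      (below-unique n)))

  ∏-solutions : (inverse : Index (suc d) → Series (suc d)) →
                (∀ i n → inverse i n ≡ (if does (multiple? i n) then 1ℤ else 0ℤ)) →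
                ∀ S n → ∏ S inverse n ≡ + length (solutions S n)
  ∏-solutions inverse inverse≡ [] n with does (≡-dec ℕ._≟_ (replicate (suc d) 0) n)
  ... | true  = refl
  ... | false = refl
  ∏-solutions inverse inverse≡ (i ∷ S) n = trans
    (∑-cong (below n) λ k → trans
      (cong₂ ℤ._*_ (inverse≡ i k) (∏-solutions inverse inverse≡ S (n ∸ᵛ k)))
      (count (multiple? i k) _))
    (sym (+length-concatMap _ (below n)))
    where
    count : ∀ {a n : Vec ℕ (suc d)} {r} (a∣n? : Dec (IsMultiple a n)) (mss : List (Vec ℕ r)) →
            (if does a∣n? then 1ℤ else 0ℤ) ℤ.* + length mss ≡ + length (prepend a∣n? mss)
    count (yes _) mss = trans (ℤ.*-identityˡ _) (cong +_ (sym (length-map _ mss)))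
    count (no _)  mss = refl

-- Partitions and their corners

shift : ∀ {d} → Index d → Fin d → Index d
shift i ℓ = i Vec.[ ℓ ]%= succ₊

-- The base value 0 never exceeds a value of `f`, so this is the true maximum over the neighbours,
-- and 0 if there are none.
next : ∀ {d} → (Index d → ℕ) → Index d → ℕ
next f i = max 0 (List.tabulate (f ∘ shift i))

shift≤next : ∀ {d} (f : Index d → ℕ) i ℓ → f (shift i ℓ) ≤ next f i
shift≤next f i = All.tabulate⁻ (xs≤max 0 (List.tabulate (f ∘ shift i)))

next≤ : ∀ {d} (f : Index d → ℕ) i {u} → (∀ ℓ → f (shift i ℓ) ≤ u) → next f i ≤ u
next≤ f i f≤u = max≤v⁺ z≤n (All.tabulate⁺ f≤u)

next-cong : ∀ {d} (f g : Index d → ℕ) i → (∀ ℓ → f (shift i ℓ) ≡ g (shift i ℓ)) → next f i ≡ next g i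
next-cong f g i f≗g = cong (max 0) (tabulate-cong f≗g)

-- The recursion f i = a i + next f i

-- The number of unit steps from (1,...,1) to `i`. It grows by one along each shift and thus
-- measures progress towards the region where everything vanishes.
rank : ∀ {d} → Index d → ℕ
rank i = Vec.sum (Vec.map ℤ₊.pred i)

rank-shift : ∀ {d} (i : Index d) ℓ → rank (shift i ℓ) ≡ suc (rank i)
rank-shift (_ ∷ i) zero        = refl
rank-shift ((1+ x) ∷ i) (suc ℓ) = trans (cong (_+_ x) (rank-shift i ℓ)) (ℕ.+-suc x (rank i))

Solves : ∀ {d} → (Index d → ℕ) → (Index d → ℕ) → Set
Solves a f = ∀ i → f i ≡ a i + next f i

-- The recursion computes a value from values one rank higher, so agreement from rank `B` on
-- propagates down to every index.
solution-unique : ∀ {d} {a f g : Index d → ℕ} B → Solves a f → Solves a g →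
                  (∀ i → B ≤ rank i → f i ≡ g i) → f ≗ g
solution-unique {a = a} {f} {g} B f-solves g-solves tail i = go B i (ℕ.m≤m+n B (rank i))
  where
  go : ∀ b i → B ≤ b + rank i → f i ≡ g i
  go zero    i B≤ = tail i B≤
  go (suc b) i B≤ = trans (f-solves i) (trans
    (cong (_+_ (a i)) (next-cong f g i λ ℓ → go b (shift i ℓ)
      (subst (B ≤_) (trans (sym (ℕ.+-suc b (rank i))) (cong (_+_ b) (sym (rank-shift i ℓ)))) B≤)))
    (sym (g-solves i)))

unfold : ∀ {d} → (Index d → ℕ) → ℕ → Index d → ℕ
unfold a zero    i = 0
unfold a (suc b) i = a i + next (unfold a b) i

-- A form of finite support suited to recursion on the rank: only finitely many indices have rank
-- below `B`.
Bounded : ∀ {d} → (Index d → ℕ) → ℕ → Set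
Bounded a B = ∀ i → B ≤ rank i → a i ≡ 0

-- The fuel B ∸ rank i drops by one along each shift.
solution : ∀ {d} → (Index d → ℕ) → ℕ → Index d → ℕ
solution a B i = unfold a (B ∸ rank i) i

solution-bounded : ∀ {d} (a : Index d → ℕ) B → Bounded (solution a B) B
solution-bounded a B i B≤ rewrite ℕ.m≤n⇒m∸n≡0 B≤ = refl

solution-solves : ∀ {d} (a : Index d → ℕ) B → Bounded a B → Solves a (solution a B)
solution-solves a B a-bounded i with B ∸ rank i in eq
-- Fuel 0 means `B ≤ rank i`, where `a i` and the values at all neighbours are 0.
... | zero  = sym (cong₂ _+_ (a-bounded i B≤)
    (ℕ.n≤0⇒n≡0 (next≤ (solution a B) i λ ℓ → ℕ.≤-reflexive
      (solution-bounded a B (shift i ℓ)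
        (ℕ.≤-trans (ℕ.m≤n⇒m≤1+n B≤) (ℕ.≤-reflexive (sym (rank-shift i ℓ))))))))
  where
  B≤ : B ≤ rank i
  B≤ = ℕ.m∸n≡0⇒m≤n eq
... | suc b = cong (_+_ (a i)) (next-cong (unfold a b) (solution a B) i λ ℓ →
  cong (λ c → unfold a c (shift i ℓ)) (sym (begin
  B ∸ rank (shift i ℓ) ≡⟨ cong (B ∸_) (rank-shift i ℓ) ⟩
  B ∸ suc (rank i)     ≡⟨ ℕ.pred[m∸n]≡m∸[1+n] B (rank i) ⟨
  ℕ.pred (B ∸ rank i)  ≡⟨ cong ℕ.pred eq ⟩
  b                    ∎)))
  where open ≡-Reasoning

-- From multiplicities to partitions

-- A comparison of indices splits into unit steps, taken one coordinate after another, so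
-- monotonicity along single shifts suffices.
antitone : ∀ {d} (f : Index d → ℕ) → (∀ i ℓ → f (shift i ℓ) ≤ f i) →
           ∀ {i j} → Pointwise _≤₊_ i j → f j ≤ f i
antitone f f-step [] = ℕ.≤-refl
antitone f f-step {(1+ x) ∷ i} {(1+ y) ∷ j} (x≤y ∷ i≤j) = ℕ.≤-trans
  (antitone (f ∘ (_ ∷_)) (λ i ℓ → f-step (_ ∷ i) (suc ℓ)) i≤j)
  (climb (ℕ.≤⇒≤′ (ℕ.s≤s⁻¹ x≤y)))
  where
  climb : ∀ {y} → x ℕ.≤′ y → f ((1+ y) ∷ i) ≤ f ((1+ x) ∷ i)
  climb ℕ.≤′-refl       = ℕ.≤-refl
  climb (ℕ.≤′-step x≤y) = ℕ.≤-trans (f-step _ zero) (climb x≤y)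

-- Since `below n` bounds the predecessors, the values reach one past the entries of `n`.
box : ∀ {d} → Vec ℕ d → List (Index d)
box n = List.map (Vec.map 1+_) (below n)

∈-box : ∀ {d} {n : Vec ℕ d} i → Vec.map ℤ₊.pred i ≤ᵛ n → i ∈ box n
∈-box {n = n} i i≤n = subst (_∈ box n)
  (trans (sym (Vec.map-∘ 1+_ ℤ₊.pred i)) (Vec.map-id i)) (∈-map⁺ (Vec.map 1+_) (∈-below⁺ i≤n))

sum≤⇒≤ᵛ : ∀ {d} (xs : Vec ℕ d) {B} → Vec.sum xs ≤ B → xs ≤ᵛ replicate d B
sum≤⇒≤ᵛ []       _   = []
sum≤⇒≤ᵛ (x ∷ xs) s≤B = ℕ.m+n≤o⇒m≤o x s≤B ∷ sum≤⇒≤ᵛ xs (ℕ.m+n≤o⇒n≤o x s≤B)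

partition : ∀ {d} (a : Index d → ℕ) B → Bounded a B → Partition d
partition {d} a B a-bounded = record
  { part       = solution a B
  ; decreasing = antitone (solution a B) λ i ℓ →
      ℕ.≤-trans (shift≤next (solution a B) i ℓ)
        (ℕ.≤-trans (ℕ.m≤n+m _ (a i)) (ℕ.≤-reflexive (sym (solution-solves a B a-bounded i))))
  ; finite     = box (replicate d B) , λ i fi≢0 →
      ∈-box i (sum≤⇒≤ᵛ _ (ℕ.≰⇒≥ λ B≤ → fi≢0 (solution-bounded a B i B≤)))
  }

≤-sum : ∀ {x xs} → x ∈ xs → x ≤ sum xs
≤-sum {xs = x ∷ xs} (here refl) = ℕ.m≤m+n x (sum xs)
≤-sum {xs = y ∷ xs} (there x∈)  = ℕ.≤-trans (≤-sum x∈) (ℕ.m≤n+m (sum xs) y)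

sum-constant : {A : Set} (x : ℕ) (ys : List A) → sum (List.map (λ _ → x) ys) ≡ length ys ℕ.* x
sum-constant x []       = refl
sum-constant x (_ ∷ ys) = cong (_+_ x) (sum-constant x ys)

-- The sum of the ranks dominates each of them, and `suc` makes the bound strict.
rankBound : ∀ {d} → List (Index d) → ℕ
rankBound is = suc (sum (List.map rank is))

∈⇒rank< : ∀ {d} {i : Index d} {is} → i ∈ is → rank i < rankBound is
∈⇒rank< i∈ = s≤s (≤-sum (∈-map⁺ rank i∈))

supported⇒bounded : ∀ {d} {a : Index d → ℕ} {is} → (∀ i → a i ≢ 0 → i ∈ is) → Bounded a (rankBound is)
supported⇒bounded {a = a} a-supp i B≤ with a i ℕ.≟ 0
... | yes ai≡0 = ai≡0
... | no ai≢0  = contradiction B≤ (ℕ.<⇒≱ (∈⇒rank< (a-supp i ai≢0)))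

partition-bounded : ∀ {d} (π : Partition d) → ∃ λ B → Bounded (part π) B
partition-bounded π = _ , supported⇒bounded (proj₂ (Partition.finite π))

-- From partitions to multiplicities

excess : ∀ {d} → Partition d → Index d → ℕ
excess π i = part π i ∸ next (part π) i

shift-≥ : ∀ {d} (i : Index d) ℓ → Pointwise _≤₊_ i (shift i ℓ)
shift-≥ (_ ∷ i) zero    = ℕ.n≤1+n _ ∷ Pointwise.refl ℕ.≤-refl
shift-≥ (_ ∷ i) (suc ℓ) = ℕ.≤-refl ∷ shift-≥ i ℓ

next≤part : ∀ {d} (π : Partition d) i → next (part π) i ≤ part π i
next≤part π i = next≤ (part π) i λ ℓ → Partition.decreasing π (shift-≥ i ℓ)

-- The truncated subtraction in `excess` is exact, because a partition is nowhere smaller than at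
-- its neighbours.
part-solves : ∀ {d} (π : Partition d) → Solves (excess π) (part π)
part-solves π i = sym (ℕ.m∸n+n≡m (next≤part π i))

excess-partition : ∀ {d} (a : Index d → ℕ) B (a-bounded : Bounded a B) → excess (partition a B a-bounded) ≗ a
excess-partition a B a-bounded i =
  trans (cong (_∸ next (solution a B) i) (solution-solves a B a-bounded i))
        (ℕ.m+n∸n≡m (a i) (next (solution a B) i))

excess-cong : ∀ {d} (π ρ : Partition d) → part π ≗ part ρ → excess π ≗ excess ρ
excess-cong π ρ π≗ρ i = cong₂ _∸_ (π≗ρ i) (next-cong (part π) (part ρ) i λ ℓ → π≗ρ (shift i ℓ))

-- Both partitions solve the recursion for the same excess, and both vanish from rank `B + C` on, so
-- `solution-unique` applies.
excess-injective : ∀ {d} (π ρ : Partition d) → excess π ≗ excess ρ → part π ≗ part ρ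
excess-injective π ρ eq =
  solution-unique (B + C) (part-solves π)
    (λ i → trans (part-solves ρ i) (cong (λ m → m + next (part ρ) i) (sym (eq i))))
    (λ i B+C≤ → trans (πB i (ℕ.m+n≤o⇒m≤o B B+C≤)) (sym (ρC i (ℕ.m+n≤o⇒n≤o B B+C≤))))
  where
  B = proj₁ (partition-bounded π)
  C = proj₁ (partition-bounded ρ)
  πB = proj₂ (partition-bounded π)
  ρC = proj₂ (partition-bounded ρ)

-- Functions supported on a list, as vectors

restrict : ∀ {d} (S : List (Index d)) → (Index d → ℕ) → Vec ℕ (length S)
restrict []      a = []
restrict (i ∷ S) a = a i ∷ restrict S a

restrict-cong : ∀ {d} S {a b : Index d → ℕ} → (∀ {i} → i ∈ S → a i ≡ b i) → restrict S a ≡ restrict S b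
restrict-cong []      a≗b = refl
restrict-cong (i ∷ S) a≗b = cong₂ _∷_ (a≗b (here refl)) (restrict-cong S (a≗b ∘ there))

-- On repeated members of `S` the first occurrence wins. Hence `restrict-extend` asks for
-- `Unique S`, whereas `extend-restrict` holds for any list containing the support.
extend : ∀ {d} (S : List (Index d)) → Vec ℕ (length S) → Index d → ℕ
extend []      _        i = 0
extend (j ∷ S) (m ∷ ms) i = if does (≡-dec _≟₊_ j i) then m else extend S ms i

extend-here : ∀ {d} (i : Index d) S {m} (ms : Vec ℕ (length S)) → extend (i ∷ S) (m ∷ ms) i ≡ m
extend-here i S ms with ≡-dec _≟₊_ i i
... | yes _  = refl
... | no i≢i = contradiction refl i≢i

extend-there : ∀ {d} {i j : Index d} S {m} (ms : Vec ℕ (length S)) → j ≢ i →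
               extend (j ∷ S) (m ∷ ms) i ≡ extend S ms i
extend-there {i = i} {j} S ms j≢i with ≡-dec _≟₊_ j i
... | yes j≡i = contradiction j≡i j≢i
... | no _    = refl

extend-supported : ∀ {d} S ms (i : Index d) → extend S ms i ≢ 0 → i ∈ S
extend-supported []      ms       i ≢0 = contradiction refl ≢0
extend-supported (j ∷ S) (m ∷ ms) i ≢0 with ≡-dec _≟₊_ j i
... | yes j≡i = here (sym j≡i)
... | no _    = there (extend-supported S ms i ≢0)

restrict-extend : ∀ {d} {S : List (Index d)} → Unique S → ∀ ms → restrict S (extend S ms) ≡ ms
restrict-extend {S = []}    []        []       = refl
restrict-extend {S = i ∷ S} (i≢S ∷ !S) (m ∷ ms) = cong₂ _∷_ (extend-here i S ms)
  (trans (restrict-cong S λ j∈ → extend-there S ms (All.lookup i≢S j∈)) (restrict-extend !S ms))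

extend-restrict : ∀ {d} {S : List (Index d)} {a} → (∀ i → a i ≢ 0 → i ∈ S) → extend S (restrict S a) ≗ a
extend-restrict {S = S} {a} a-supp i with a i ℕ.≟ 0
... | no ai≢0  = go (a-supp i ai≢0)
  where
  go : ∀ {S} → i ∈ S → extend S (restrict S a) i ≡ a i
  go {j ∷ S} i∈ with ≡-dec _≟₊_ j i | i∈
  ... | yes refl | _         = refl
  ... | no j≢i   | here refl = contradiction refl j≢i
  ... | no _     | there i∈S = go i∈S
... | yes ai≡0 = trans (go S) (sym ai≡0)
  where
  go : ∀ S → extend S (restrict S a) i ≡ 0
  go []      = refl
  go (j ∷ S) with ≡-dec _≟₊_ j i
  ... | yes refl = ai≡0
  ... | no _     = go S

lookup-weight : ∀ {d} (S : List (Index d)) a ℓ →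
                lookup (weight S (restrict S a)) ℓ ≡ sum (List.map (λ i → a i ℕ.* value (lookup i ℓ)) S)
lookup-weight []      a ℓ = Vec.lookup-replicate ℓ 0
lookup-weight (i ∷ S) a ℓ = trans (Vec.lookup-zipWith _+_ ℓ (a i · exponent i) (weight S (restrict S a)))
  (cong₂ _+_ (trans (Vec.lookup-map ℓ (a i ℕ.*_) (exponent i)) (cong (a i ℕ.*_) (Vec.lookup-map ℓ value i)))
             (lookup-weight S a ℓ))

-- Corners in terms of the excess

module _ {d} (π : Partition d) where

  -- Missing the diagram at every neighbour means lying above all their values, hence above the
  -- maximum. Positivity of the height takes care of the base value 0.
  corner⇒ : ∀ {i k} → Corner π (i , k) → next (part π) i < value k × value k ≤ part π i
  corner⇒ {i} {1+ k} (k≤ , top) = s≤s (next≤ (part π) i λ ℓ → ℕ.s≤s⁻¹ (ℕ.≰⇒> (top ℓ))) , k≤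

  ⇒corner : ∀ {i k} → next (part π) i < value k → value k ≤ part π i → Corner π (i , k)
  ⇒corner {i} next<k k≤ = k≤ , λ ℓ → ℕ.<⇒≱ (ℕ.≤-<-trans (shift≤next (part π) i ℓ) next<k)

  -- The offset makes the heights run from `next + 1` to `part`.
  cornersAbove : Index d → List (Point d)
  cornersAbove i = List.map (λ k → i , 1+ (next (part π) i + k)) (upTo (excess π i))

  ∈-cornersAbove⁻ : ∀ {i v} → v ∈ cornersAbove i → proj₁ v ≡ i × Corner π v
  ∈-cornersAbove⁻ {i} v∈ with ∈-map⁻ _ v∈
  ... | k , k∈ , refl = refl , ⇒corner (s≤s (ℕ.m≤m+n (next (part π) i) k)) (begin
    suc (next (part π) i + k)      ≡⟨ ℕ.+-suc _ k ⟨
    next (part π) i + suc k        ≤⟨ ℕ.+-monoʳ-≤ (next (part π) i) (∈-upTo⁻ k∈) ⟩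
    next (part π) i + excess π i   ≡⟨ ℕ.m+[n∸m]≡n (next≤part π i) ⟩
    part π i                       ∎)
    where open ℕ.≤-Reasoning

  ∈-cornersAbove⁺ : ∀ {i k} → Corner π (i , k) → (i , k) ∈ cornersAbove i
  ∈-cornersAbove⁺ {i} {1+ k} corner with corner⇒ corner
  ... | s≤s next≤k , k<part = subst (λ m → (i , 1+ m) ∈ cornersAbove i) (ℕ.m+[n∸m]≡n next≤k)
    (∈-map⁺ _ (∈-upTo⁺ (ℕ.∸-monoˡ-< k<part next≤k)))

  corner⇒excess≢0 : ∀ {i k} → Corner π (i , k) → excess π i ≢ 0
  corner⇒excess≢0 corner with corner⇒ corner
  ... | next<k , k≤part = ℕ.m<n⇒n≢0 (ℕ.m<n⇒0<n∸m (ℕ.<-≤-trans next<k k≤part))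

  excess≢0⇒corner : ∀ i → excess π i ≢ 0 → ∃ λ k → Corner π (i , k)
  -- The lowest corner above `i`.
  excess≢0⇒corner i ≢0 = 1+ (next (part π) i) ,
    ⇒corner ℕ.≤-refl (ℕ.m∸n≢0⇒n<m ≢0)

  -- Some corner lies above `i` and contributes its coordinate to the sum `c π ℓ` of natural
  -- numbers. Thus `c π` confines the support of the excess to a box.
  excess-support : ∀ i → excess π i ≢ 0 → ∀ ℓ → value (lookup i ℓ) ≤ c π ℓ
  excess-support i ≢0 ℓ = ≤-sum (∈-map⁺ _ (Equivalence.from (∈-corners π) (proj₂ (excess≢0⇒corner i ≢0))))

  -- Both lists are free of repetitions and have the same members. Indices of `S` outside the
  -- support contribute empty lists.
  corners-↭ : ∀ {S} → Unique S → (∀ i → excess π i ≢ 0 → i ∈ S) → corners π ↭ concatMap cornersAbove S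
  corners-↭ {S} !S supp = ∼bag⇒↭ (unique∧set⇒bag (corners-unique π) unique (mk⇔
    (λ v∈ → let corner = Equivalence.to (∈-corners π) v∈ in
      ∈-concatMap⁺ cornersAbove (lose (supp _ (corner⇒excess≢0 corner)) (∈-cornersAbove⁺ corner)))
    (λ v∈ → let _ , _ , v∈′ = find (∈-concatMap⁻ cornersAbove {xs = S} v∈) in
      Equivalence.from (∈-corners π) (proj₂ (∈-cornersAbove⁻ v∈′)))))
    where
    unique : Unique (concatMap cornersAbove S)
    unique = concat⁺
      (All.map⁺ (All.universal (λ i → map⁺
        (λ eq → ℕ.+-cancelˡ-≡ (next (part π) i) _ _ (cong (ℤ₊.pred ∘ proj₂) eq)) (upTo⁺ (excess π i))) S))
      (AllPairs.map⁺ (AllPairs.map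
        (λ { i≢j (p , q) → i≢j (trans (sym (proj₁ (∈-cornersAbove⁻ p))) (proj₁ (∈-cornersAbove⁻ q))) }) !S))

  sum-cornersAbove : ∀ ℓ S → sum (List.map (λ v → value (lookup (proj₁ v) ℓ)) (concatMap cornersAbove S)) ≡
                     sum (List.map (λ i → excess π i ℕ.* value (lookup i ℓ)) S)
  sum-cornersAbove ℓ []      = refl
  sum-cornersAbove ℓ (i ∷ S) = begin
    sum (List.map w (cornersAbove i ++ concatMap cornersAbove S))
      ≡⟨ cong sum (map-++ w (cornersAbove i) _) ⟩
    sum (List.map w (cornersAbove i) ++ List.map w (concatMap cornersAbove S))
      ≡⟨ sum-++ (List.map w (cornersAbove i)) _ ⟩
    sum (List.map w (cornersAbove i)) + sum (List.map w (concatMap cornersAbove S))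
      ≡⟨ cong₂ _+_ (begin
           sum (List.map w (cornersAbove i))
             ≡⟨ cong sum (map-∘ (upTo (excess π i))) ⟨
           sum (List.map (λ _ → value (lookup i ℓ)) (upTo (excess π i)))
             ≡⟨ sum-constant _ (upTo (excess π i)) ⟩
           length (upTo (excess π i)) ℕ.* value (lookup i ℓ)
             ≡⟨ cong (ℕ._* value (lookup i ℓ)) (length-upTo (excess π i)) ⟩
           excess π i ℕ.* value (lookup i ℓ)
             ∎)
           (sum-cornersAbove ℓ S) ⟩
    excess π i ℕ.* value (lookup i ℓ) + sum (List.map (λ i → excess π i ℕ.* value (lookup i ℓ)) S)
      ∎
    where
    open ≡-Reasoning
    w : Point d → ℕ
    w v = value (lookup (proj₁ v) ℓ)

  -- Grouping the corners by their base index, each `i` contributes itself `excess π i` times. This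
  -- turns the condition on corners into one on multiplicity vectors.
  c≡weight : ∀ {S} → Unique S → (∀ i → excess π i ≢ 0 → i ∈ S) →
             Vec.tabulate (c π) ≡ weight S (restrict S (excess π))
  c≡weight {S} !S supp = trans (Vec.tabulate-cong λ ℓ → trans
      (sum-↭ (↭.map⁺ _ (corners-↭ !S supp)))
      (trans (sum-cornersAbove ℓ S) (sym (lookup-weight S (excess π) ℓ))))
    (Vec.tabulate∘lookup _)

-- Multiplicity vectors of weight n and the fibre over n

lookup-injective : {A : Set} {xs : List A} → Unique xs → ∀ i j → List.lookup xs i ≡ List.lookup xs j → i ≡ j
lookup-injective (_ ∷ _)     zero    zero    _  = refl
lookup-injective (x≢xs ∷ _)  zero    (suc j) eq = contradiction eq (All.lookup x≢xs (∈-lookup j))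
lookup-injective (x≢xs ∷ _)  (suc i) zero    eq = contradiction (sym eq) (All.lookup x≢xs (∈-lookup i))
lookup-injective (_ ∷ !xs)   (suc i) (suc j) eq = cong suc (lookup-injective !xs i j eq)

pred≤ᵛ : ∀ {d} (n : Vec ℕ d) (i : Index d) → (∀ ℓ → value (lookup i ℓ) ≤ lookup n ℓ) →
         Vec.map ℤ₊.pred i ≤ᵛ n
pred≤ᵛ []      []      _   = []
pred≤ᵛ (_ ∷ n) (_ ∷ i) i≤n = ℕ.<⇒≤ (i≤n zero) ∷ pred≤ᵛ n i (i≤n ∘ suc)

-- Every partition in the fibre has its excess supported in `S`, by `excess-support`. So
-- `restrict S` of the excess and `partitionOf` are mutually inverse between the fibre and the
-- vectors enumerated by `mss`.
fibre-cardinality : ∀ {d} (n : Vec ℕ d) {S : List (Index d)} → Unique S →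
                    (∀ i → (∀ ℓ → value (lookup i ℓ) ≤ lookup n ℓ) → i ∈ S) →
                    (mss : List (Vec ℕ (length S))) → Unique mss →
                    (∀ {ms} → ms ∈ mss → weight S ms ≡ n) → (∀ ms → weight S ms ≡ n → ms ∈ mss) →
                    HasCardinality (CornerFibre n) (length mss)
fibre-cardinality {d} n {S} !S box⊆S mss !mss sound complete = record
  { to        = to
  ; cong      = λ { refl _ → refl }
  ; bijective = (λ {i} {j} → injective i j) , surjective
  }
  where
  partitionOf : Vec ℕ (length S) → Partition d
  partitionOf ms = partition (extend S ms) _ (supported⇒bounded (extend-supported S ms))

  excess-partitionOf : ∀ ms → excess (partitionOf ms) ≗ extend S ms
  excess-partitionOf ms = excess-partition (extend S ms) _ (supported⇒bounded (extend-supported S ms))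

  restrict-partitionOf : ∀ ms → restrict S (excess (partitionOf ms)) ≡ ms
  restrict-partitionOf ms =
    trans (restrict-cong S (λ {i} _ → excess-partitionOf ms i)) (restrict-extend !S ms)

  to : Fin (length mss) → Σ (Partition d) (λ π → Vec.tabulate (c π) ≡ n)
  to x = partitionOf ms ,
    trans (c≡weight (partitionOf ms) !S
             (λ i ≢0 → extend-supported S ms i (≢0 ∘ trans (excess-partitionOf ms i))))
          (trans (cong (weight S) (restrict-partitionOf ms)) (sound (∈-lookup x)))
    where ms = List.lookup mss x

  injective : ∀ x y → part (proj₁ (to x)) ≗ part (proj₁ (to y)) → x ≡ y
  injective x y eq = lookup-injective !mss x y (begin
    List.lookup mss x                   ≡⟨ restrict-partitionOf (List.lookup mss x) ⟨
    restrict S (excess (proj₁ (to x)))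
      ≡⟨ restrict-cong S (λ {i} _ → excess-cong (proj₁ (to x)) (proj₁ (to y)) eq i) ⟩
    restrict S (excess (proj₁ (to y)))  ≡⟨ restrict-partitionOf (List.lookup mss y) ⟩
    List.lookup mss y                   ∎)
    where open ≡-Reasoning

  surjective : ∀ (y : Σ (Partition d) (λ π → Vec.tabulate (c π) ≡ n)) →
               ∃ λ x → ∀ {z} → z ≡ x → part (proj₁ (to z)) ≗ part (proj₁ y)
  surjective (π , cπ≡n) = index ms∈ ,
    λ { refl → excess-injective (partitionOf (List.lookup mss (index ms∈))) π λ i → begin
      excess (partitionOf (List.lookup mss (index ms∈))) i ≡⟨ excess-partitionOf _ i ⟩
      extend S (List.lookup mss (index ms∈)) i             ≡⟨ cong (λ ms → extend S ms i) (Any.lookup-index ms∈) ⟨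
      extend S (restrict S (excess π)) i                   ≡⟨ extend-restrict supp i ⟩
      excess π i                                           ∎ }
    where
    open ≡-Reasoning
    supp : ∀ i → excess π i ≢ 0 → i ∈ S
    supp i ≢0 = box⊆S i λ ℓ → ℕ.≤-trans (excess-support π i ≢0 ℓ)
      (ℕ.≤-reflexive (trans (sym (Vec.lookup∘tabulate (c π) ℓ)) (cong (λ v → lookup v ℓ) cπ≡n)))

    ms∈ : restrict S (excess π) ∈ mss
    ms∈ = complete _ (trans (sym (c≡weight π !S supp)) cπ≡n)

lemma5p1 : (d : ℕ) → 1 ≤ d →
    (p : Vec ℕ d → ℤ) → IsVectorPartitionNumbers p →
    (n : Vec ℕ d) →
    ∃ λ (k : ℕ) → HasCardinality (CornerFibre n) k × p n ≡ + k
lemma5p1 (suc d) _ p P n =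
  length (solutions S n) ,
  fibre-cardinality n !S box⊆S (solutions S n) (solutions-unique S n) (∈-solutions⁻ S n)
    (λ ms eq → subst (λ k → ms ∈ solutions S k) eq (∈-solutions⁺ S ms)) ,
  trans (sym (proj₂ (isProduct n) S !S (λ i∈ → ∈-deduplicate⁺ (≡-dec _≟₊_) (∈-++⁺ˡ i∈))))
        (∏-solutions inverse (λ i k → proj₂ (multiples i k)) S n)
  where
  open IsVectorPartitionNumbers P

  multiples : ∀ i k → Σ (Dec (IsMultiple (exponent i) k)) λ i∣k? →
              inverse i k ≡ (if does i∣k? then 1ℤ else 0ℤ)
  -- Dimension at least 1 supplies the first entry, whose value `suc x` is the positive head that
  -- drives the descent in `geometric`.
  multiples i@((1+ x) ∷ xs) = geometric x (exponent xs) (inverse i) (isInverse i)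

  open Solutions (λ i k → proj₁ (multiples i k))

  S : List (Index (suc d))
  -- One list serves both counts: the first piece makes the coefficient at `n` of the finite product
  -- equal to `p n`, and `box n` contains every index that can carry an excess in the fibre over
  -- `n`.
  S = deduplicate (≡-dec _≟₊_) (proj₁ (isProduct n) ++ box n)

  !S : Unique S
  !S = deduplicate-! (≡-dec _≟₊_) _

  box⊆S : ∀ i → (∀ ℓ → value (lookup i ℓ) ≤ lookup n ℓ) → i ∈ S
  box⊆S i i≤n = ∈-deduplicate⁺ (≡-dec _≟₊_) (∈-++⁺ʳ (proj₁ (isProduct n)) (∈-box i (pred≤ᵛ n i i≤n)))
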